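{- For $a\ge 2$ let $K_{a,a}$ denote the useful orientation of the complete bipartite graph with both parts of size $a$, and let $c=a(a-2)+1$. Then $T_c(K_{a,a})=\Omega(a!)$ as $a\to\infty$; that is, there exist a constant $\kappa>0$ and an integer $N$ such that for all $a\ge N$, with $c=a(a-2)+1$, one has $T_c(K_{a,a})\ge\kappa\, a!$.
   Context: A directed graph $D=(V,E)$ is a finite set of vertices $V$ with a set $E$ of ordered pairs of vertices; $(u,v)\in E$ is an edge directed from $u$ to $v$, and the out-degree $\deg^+ v$ is the number of edges directed from $v$. A parallel chip-firing game on $D$ starts with a finite nonnegative integer number of chips on each vertex. In each round, simultaneously, every vertex $v$ having at least $\deg^+ v$ chips fires, sending one chip along each of its outgoing edges; all other vertices wait. The game has period $T$ if $T$ is the smallest positive integer for which there is a round $t_0$ such that every vertex has the same number of chips in round $t$ as in round $t+T$ for all $t\ge t_0$. For a nonnegative integer $c$, the $c$-convergent period $T_c(D)$ is the minimum of the period $T$ over all parallel chip-firing games on $D$ with at least $c$ chips in total. The useful orientation of the complete bipartite graph with vertices $v_1,\dots,v_{2a}$, where the odd-indexed vertices form one part $L$ and the even-indexed vertices form the other part $R$, has exactly the following edges: (i) from $v_i$ to $v_{i+1}$ for each $1\le i<2a$, and from $v_{2a}$ to $v_1$; (ii) from $v_1$ to $v_{2i}$ for all $1\le i<a$; (iii) from $v_{2j+1}$ to all vertices $v_{2k}$ with $1\le k<j$ (for every $j$ with $1\le j\le a-1$); (iv) from $v_{2j}$ to all vertices $v_{2k-1}$ with $1<k<j$ (for every $j$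 with $1\le j\le a$). -}

module Defs where

import Algebra.Properties.CommutativeMonoid.Sum
open import Data.Bool.Base using (Bool; if_then_else_; _∧_)
open import Data.Fin.Base using (Fin; toℕ; fromℕ<; funToFin; finToFun)
  renaming (zero to fzero; suc to fsuc)
open import Data.Fin.Properties using (pigeonhole; finToFun-funToFin; toℕ-fromℕ<)
open import Data.Nat.Base
  using (ℕ; zero; suc; _+_; _*_; _∸_; _^_; _≤_; _<_; NonZero; >-nonZero⁻¹; s≤s; s≤s⁻¹)
open import Data.Nat.Induction using (<-rec)
open import Data.Nat.Properties
open import Data.Product.Base using (_×_; _,_; ∃; ∃-syntax)
open import Data.Sum.Base using (_⊎_; inj₁; inj₂)
open import Data.Vec.Functional using (Vector)
open import Function.Base using (_∘_; case_of_)
open import Relation.Binary.Definitions using (Decidable)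
open import Relation.Binary.PropositionalEquality
open import Relation.Nullary using (¬_; Dec; does; yes; no; contradiction)
open import Relation.Nullary.Decidable using (map′; _×-dec_; _⊎-dec_)

open Algebra.Properties.CommutativeMonoid.Sum +-0-commutativeMonoid public
  using (sum; sum-cong-≗; ∑-distrib-+; ∑-comm; sum-syntax)

record Digraph (n : ℕ) : Set₁ where
  field
    Edge  : Fin n → Fin n → Set
    edge? : Decidable Edge

𝟙 : Bool → ℕ
𝟙 b = if b then 1 else 0

Config : ℕ → Set
Config n = Vector ℕ n

module ChipFiring {n : ℕ} (D : Digraph n) where
  open Digraph D

  outdeg : Fin n → ℕ
  outdeg v = ∑[ u < n ] 𝟙 (does (edge? v u))

  fires? : (σ : Config n) (v : Fin n) → Dec (outdeg v ≤ σ v)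
  fires? σ v = outdeg v ≤? σ v

  sent : Config n → Fin n → Fin n → ℕ
  sent σ u v = 𝟙 (does (fires? σ u) ∧ does (edge? u v))

  kept : Config n → Fin n → ℕ
  kept σ v = if does (fires? σ v) then σ v ∸ outdeg v else σ v

  step : Config n → Config n
  step σ v = kept σ v + ∑[ u < n ] sent σ u v

  game : Config n → ℕ → Config n
  game σ zero    = σ
  game σ (suc t) = step (game σ t)

  EventuallyRepeats : Config n → ℕ → Set
  EventuallyRepeats σ T =
    ∃[ t₀ ] ∀ t → t₀ ≤ t → ∀ v → game σ t v ≡ game σ (t + T) v

Least : (ℕ → Set) → ℕ → Set
Least P m = P m × (∀ k → P k → m ≤ k)

module _ {n : ℕ} (D : Digraph n) where
  open ChipFiring D

  IsPeriod : Config n → ℕ → Set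
  IsPeriod σ = Least (λ T → 0 < T × EventuallyRepeats σ T)

  PeriodWithAtLeast : ℕ → ℕ → Set
  PeriodWithAtLeast c T = ∃[ σ ] (c ≤ sum σ × IsPeriod σ T)

  -- The graph of the partial function (D , c) ↦ T_c(D).  See
  -- convergentPeriod-unique and convergentPeriod-exists below.
  IsConvergentPeriod : ℕ → ℕ → Set
  IsConvergentPeriod c = Least (PeriodWithAtLeast c)

-- Edges in terms of the indices 1 , … , 2a of the vertices.
data UsefulEdge (a : ℕ) : ℕ → ℕ → Set where
  path  : ∀ {i} → 1 ≤ i → i < 2 * a → UsefulEdge a i (suc i)
  close : UsefulEdge a (2 * a) 1
  first : ∀ {i} → 1 ≤ i → i < a → UsefulEdge a 1 (2 * i)
  odd   : ∀ {j k} → 1 ≤ j → j ≤ a ∸ 1 → 1 ≤ k → k < j →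
          UsefulEdge a (2 * j + 1) (2 * k)
  even  : ∀ {j k} → 1 ≤ j → j ≤ a → 1 < k → k < j →
          UsefulEdge a (2 * j) (2 * k ∸ 1)

usefulEdge? : ∀ a → Decidable (UsefulEdge a)
usefulEdge? a p q = map′ to from
  (    (1 ≤? p ×-dec p <? 2 * a ×-dec q ≟ suc p)
  ⊎-dec (p ≟ 2 * a ×-dec q ≟ 1)
  ⊎-dec (p ≟ 1 ×-dec anyUpTo? (λ i → 1 ≤? i ×-dec q ≟ 2 * i) a)
  ⊎-dec anyUpTo? (λ j → 1 ≤? j ×-dec p ≟ 2 * j + 1 ×-dec
          anyUpTo? (λ k → 1 ≤? k ×-dec q ≟ 2 * k) j) (suc (a ∸ 1))
  ⊎-dec anyUpTo? (λ j → 1 ≤? j ×-dec p ≟ 2 * j ×-dec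
          anyUpTo? (λ k → 1 <? k ×-dec q ≟ 2 * k ∸ 1) j) (suc a))
  where
  Cases : Set
  Cases =
      (1 ≤ p × p < 2 * a × q ≡ suc p)
    ⊎ (p ≡ 2 * a × q ≡ 1)
    ⊎ (p ≡ 1 × ∃[ i ] (i < a × 1 ≤ i × q ≡ 2 * i))
    ⊎ (∃[ j ] (j < suc (a ∸ 1) × 1 ≤ j × p ≡ 2 * j + 1 ×
         ∃[ k ] (k < j × 1 ≤ k × q ≡ 2 * k)))
    ⊎ (∃[ j ] (j < suc a × 1 ≤ j × p ≡ 2 * j ×
         ∃[ k ] (k < j × 1 < k × q ≡ 2 * k ∸ 1)))

  to : Cases → UsefulEdge a p q
  to (inj₁ (1≤p , p<2a , refl)) = path 1≤p p<2a
  to (inj₂ (inj₁ (refl , refl))) = close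
  to (inj₂ (inj₂ (inj₁ (refl , _ , i<a , 1≤i , refl)))) = first 1≤i i<a
  to (inj₂ (inj₂ (inj₂ (inj₁
    (_ , j<a , 1≤j , refl , _ , k<j , 1≤k , refl))))) =
    odd 1≤j (s≤s⁻¹ j<a) 1≤k k<j
  to (inj₂ (inj₂ (inj₂ (inj₂
    (_ , j≤a , 1≤j , refl , _ , k<j , 1<k , refl))))) =
    even 1≤j (s≤s⁻¹ j≤a) 1<k k<j

  from : UsefulEdge a p q → Cases
  from (path 1≤p p<2a) = inj₁ (1≤p , p<2a , refl)
  from close = inj₂ (inj₁ (refl , refl))
  from (first 1≤i i<a) = inj₂ (inj₂ (inj₁ (refl , _ , i<a , 1≤i , refl)))
  from (odd 1≤j j<a 1≤k k<j) = inj₂ (inj₂ (inj₂ (inj₁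
    (_ , s≤s j<a , 1≤j , refl , _ , k<j , 1≤k , refl))))
  from (even 1≤j j≤a 1<k k<j) = inj₂ (inj₂ (inj₂ (inj₂
    (_ , s≤s j≤a , 1≤j , refl , _ , k<j , 1<k , refl))))

-- v : Fin (2 * a) is the vertex with index suc (toℕ v).
usefulK : ∀ a → Digraph (2 * a)
usefulK a = record
  { Edge  = λ u v → UsefulEdge a (suc (toℕ u)) (suc (toℕ v))
  ; edge? = λ u v → usefulEdge? a (suc (toℕ u)) (suc (toℕ v))
  }

-- T_c(D) is well defined: it is unique, and (classically) it exists as
-- soon as D has a vertex.

module _ {n : ℕ} (D : Digraph n) where
  open Digraph D
  open ChipFiring D

  convergentPeriod-unique : ∀ {c T T′} → IsConvergentPeriod D c T →
                            IsConvergentPeriod D c T′ → T ≡ T′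
  convergentPeriod-unique (p , least) (p′ , least′) =
    ≤-antisym (least _ p′) (least′ _ p)

  step-cong : ∀ {σ τ} → σ ≗ τ → step σ ≗ step τ
  step-cong {σ} {τ} σ≗τ v = cong₂ _+_
    (cong (λ x → if does (outdeg v ≤? x) then x ∸ outdeg v else x) (σ≗τ v))
    (sum-cong-≗ λ u →
      cong (λ x → 𝟙 (does (outdeg u ≤? x) ∧ does (edge? u v))) (σ≗τ u))

  sum-step : ∀ σ → sum (step σ) ≡ sum σ
  sum-step σ = begin
    sum (step σ)
      ≡⟨ ∑-distrib-+ (kept σ) (λ v → ∑[ u < n ] sent σ u v) ⟩
    sum (kept σ) + ∑[ v < n ] ∑[ u < n ] sent σ u v
      ≡⟨ cong (sum (kept σ) +_) (∑-comm λ v u → sent σ u v) ⟩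
    sum (kept σ) + ∑[ u < n ] ∑[ v < n ] sent σ u v
      ≡⟨ ∑-distrib-+ (kept σ) (λ u → ∑[ v < n ] sent σ u v) ⟨
    ∑[ u < n ] (kept σ u + ∑[ v < n ] sent σ u v)
      ≡⟨ sum-cong-≗ kept+sent ⟩
    sum σ ∎
    where
    open ≡-Reasoning
    sum-0 : ∀ m → ∑[ i < m ] 0 ≡ 0
    sum-0 zero    = refl
    sum-0 (suc m) = sum-0 m

    go : ∀ u (d : Dec (outdeg u ≤ σ u)) →
         (if does d then σ u ∸ outdeg u else σ u) +
         ∑[ v < n ] 𝟙 (does d ∧ does (edge? u v)) ≡ σ u
    go u (yes d≤σ) = m∸n+n≡m d≤σ
    go u (no  _)   = trans (cong (σ u +_) (sum-0 n)) (+-identityʳ (σ u))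

    kept+sent : ∀ u → kept σ u + ∑[ v < n ] sent σ u v ≡ σ u
    kept+sent u = go u (fires? σ u)

  sum-game : ∀ σ t → sum (game σ t) ≡ sum σ
  sum-game σ zero    = refl
  sum-game σ (suc t) = trans (sum-step (game σ t)) (sum-game σ t)

  term≤sum : ∀ {m} (f : Vector ℕ m) i → f i ≤ sum f
  term≤sum f fzero    = m≤m+n (f fzero) _
  term≤sum f (fsuc i) = ≤-trans (term≤sum (f ∘ fsuc) i) (m≤n+m _ (f fzero))

  game-cong : ∀ {σ s t} → game σ s ≗ game σ t →
              ∀ k → game σ (k + s) ≗ game σ (k + t)
  game-cong eq zero    = eq
  game-cong eq (suc k) = step-cong (game-cong eq k)

  eventuallyRepeats : ∀ σ → ∃[ T ] (0 < T × EventuallyRepeats σ T)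
  eventuallyRepeats σ =
    let i , j , i<j , same = pigeonhole (n<1+n (suc (sum σ) ^ n)) (code ∘ toℕ)
    in toℕ j ∸ toℕ i , m<n⇒0<n∸m i<j , toℕ i , λ t i≤t v →
        subst₂ (λ x y → game σ x v ≡ game σ y v)
          (m∸n+n≡m i≤t) (shift i≤t (<⇒≤ i<j))
          (game-cong (decode (toℕ i) (toℕ j) same) (t ∸ toℕ i) v)
    where
    bound : ∀ t v → game σ t v < suc (sum σ)
    bound t v = s≤s (≤-trans (term≤sum (game σ t) v) (≤-reflexive (sum-game σ t)))

    digits : ℕ → Fin n → Fin (suc (sum σ))
    digits t v = fromℕ< (bound t v)

    code : ℕ → Fin (suc (sum σ) ^ n)
    code t = funToFin (digits t)

    decode : ∀ s t → code s ≡ code t → game σ s ≗ game σ t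
    decode s t eq v = begin
      game σ s v                      ≡⟨ toℕ-fromℕ< (bound s v) ⟨
      toℕ (digits s v)                ≡⟨ cong toℕ (finToFun-funToFin (digits s) v) ⟨
      toℕ (finToFun (code s) v)       ≡⟨ cong (λ x → toℕ (finToFun x v)) eq ⟩
      toℕ (finToFun (code t) v)       ≡⟨ cong toℕ (finToFun-funToFin (digits t) v) ⟩
      toℕ (digits t v)                ≡⟨ toℕ-fromℕ< (bound t v) ⟩
      game σ t v                      ∎
      where open ≡-Reasoning

    shift : ∀ {t i j} → i ≤ t → i ≤ j → (t ∸ i) + j ≡ t + (j ∸ i)
    shift {t} {i} {j} i≤t i≤j = begin
      (t ∸ i) + j               ≡⟨ cong ((t ∸ i) +_) (m+[n∸m]≡n i≤j) ⟨
      (t ∸ i) + (i + (j ∸ i))   ≡⟨ +-assoc (t ∸ i) i (j ∸ i) ⟨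
      (t ∸ i) + i + (j ∸ i)     ≡⟨ cong (_+ (j ∸ i)) (m∸n+n≡m i≤t) ⟩
      t + (j ∸ i)               ∎
      where open ≡-Reasoning

  least-exists : ∀ (P : ℕ → Set) m → P m → ¬ ¬ ∃ (Least P)
  least-exists P = <-rec _ λ m rec Pm none → none (m , Pm , λ k Pk →
    case m ≤? k of λ where
      (yes m≤k) → m≤k
      (no  m≰k) → contradiction none (rec (≰⇒> m≰k) Pk))

  convergentPeriod-exists : .{{NonZero n}} → ∀ c →
                            ¬ ¬ ∃ (IsConvergentPeriod D c)
  convergentPeriod-exists c none =
    let T , repeats = eventuallyRepeats (λ _ → c) in
    least-exists _ T repeats λ (T′ , period) →
    least-exists (PeriodWithAtLeast D c) T′
      ((λ _ → c) , term≤sum (λ _ → c) (fromℕ< (>-nonZero⁻¹ n)) , period) none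

{-# OPTIONS --safe #-}
module Submission where

-- Over one period every vertex sends as many chips as it receives, so the
-- firing counts x satisfy deg⁺(v) x(v) = Σ x(u), summed over the edges u → v.
-- The out-degrees add up to a², so with more than a² - 2a = a (a - 2) chips some
-- vertex fires in every round and x ≠ 0.  For the useful orientation these
-- equations determine x from x(v₁), going down from v₂ₐ.  The counts grow so fast
-- on the way that the subtracted sums of earlier entries never exceed the entry
-- just computed.  Hence x(v₇) ≥ a!, and no vertex fires more than T times.

open import Data.Bool.Base using (Bool; true; false; _∧_; _∨_; if_then_else_)
open import Data.Fin.Base using (Fin; toℕ; fromℕ<)
open import Data.Fin.Properties using (any?; toℕ<n; fromℕ<-toℕ; toℕ-fromℕ<)
open import Data.Integer.Base using (+_; +≤+)
import Data.Integer.Properties as ℤ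
open import Data.Nat.Base hiding (_/_)
open import Data.Nat.Properties
open import Data.Nat.Tactic.RingSolver using (solve-∀)
open import Data.Product.Base using (_×_; _,_; ∃-syntax)
open import Data.Rational.Base using (ℚ; 0ℚ; 1ℚ; _/_; fromℚᵘ; toℚᵘ) renaming (_*_ to _*ℚ_; _<_ to _<ℚ_; _≤_ to _≤ℚ_)
import Data.Rational.Properties as ℚ
open import Data.Rational.Unnormalised.Base as ℚᵘ using (mkℚᵘ)
import Data.Rational.Unnormalised.Properties as ℚᵘ
open import Data.Sum.Base using (_⊎_; inj₁; inj₂)
open import Function.Base using (_∘_)
open import Function.Bundles using (mk⇔)
open import Relation.Binary.PropositionalEquality
open import Relation.Nullary using (¬_; Dec; does; yes; no; contradiction)
open import Relation.Nullary.Decidable using (does-⇔; dec-false; dec-true; _⊎-dec_)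
open import Defs

-- `_/_` divides by a gcd, which does not compute for a variable numerator, so the comparison is
-- made between unnormalised fractions.
/1-mono-≤ : ∀ {m n} → m ≤ n → (+ m / 1) ≤ℚ (+ n / 1)
/1-mono-≤ {m} {n} m≤n = ℚ.toℚᵘ-cancel-≤ (begin
  toℚᵘ (fromℚᵘ (mkℚᵘ (+ m) 0)) ≃⟨ ℚ.toℚᵘ-fromℚᵘ (mkℚᵘ (+ m) 0) ⟩
  mkℚᵘ (+ m) 0                   ≤⟨ ℚᵘ.*≤* (ℤ.*-monoʳ-≤-nonNeg (+ 1) (+≤+ m≤n)) ⟩
  mkℚᵘ (+ n) 0                   ≃⟨ ℚ.toℚᵘ-fromℚᵘ (mkℚᵘ (+ n) 0) ⟨
  toℚᵘ (fromℚᵘ (mkℚᵘ (+ n) 0)) ∎)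
  where open ℚᵘ.≤-Reasoning

-- Finite sums over initial segments of ℕ

∑< : ℕ → (ℕ → ℕ) → ℕ
∑< n f = ∑[ i < n ] f (toℕ i)

∑<-cong : ∀ {f g} n → (∀ k → k < n → f k ≡ g k) → ∑< n f ≡ ∑< n g
∑<-cong n eq = sum-cong-≗ {n} λ i → eq (toℕ i) (toℕ<n i)

∑<-0 : ∀ n → ∑< n (λ _ → 0) ≡ 0
∑<-0 zero    = refl
∑<-0 (suc n) = ∑<-0 n

∑<-distrib-+ : ∀ n f g → ∑< n (λ k → f k + g k) ≡ ∑< n f + ∑< n g
∑<-distrib-+ n f g = ∑-distrib-+ {n} (f ∘ toℕ) (g ∘ toℕ)

∑<-*-+ : ∀ n (f g h : ℕ → ℕ) → ∑< n (λ k → (f k + g k) * h k) ≡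
         ∑< n (λ k → f k * h k) + ∑< n (λ k → g k * h k)
∑<-*-+ n f g h = trans
  (∑<-cong n λ k _ → *-distribʳ-+ (h k) (f k) (g k))
  (∑<-distrib-+ n (λ k → f k * h k) (λ k → g k * h k))

∑<-δ : ∀ {n i} (f : ℕ → ℕ) → i < n → ∑< n (λ k → 𝟙 (k ≡ᵇ i) * f k) ≡ f i
∑<-δ {suc n} {zero}  f _         = trans
  (cong₂ _+_ (+-identityʳ (f 0)) (∑<-0 n)) (+-identityʳ (f 0))
∑<-δ {suc n} {suc i} f (s≤s i<n) = ∑<-δ (f ∘ suc) i<n

∑<-δ-row : ∀ {n i} → i < n → ∑< n (λ k → 𝟙 (i ≡ᵇ k)) ≡ 1
∑<-δ-row {suc n} {zero}  _         = cong suc (∑<-0 n)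
∑<-δ-row {suc n} {suc i} (s≤s i<n) = ∑<-δ-row i<n

-- Shaped for the cycle edge leaving the right vertex i: it enters the left vertex i + 1, or, for i
-- = n, the left vertex 0, whose term stands first in a sum over the left side.
∑<-δ-rowˡ : ∀ {n i} → i ≤ n → 𝟙 (i ≡ᵇ n) + ∑< n (λ k → 𝟙 (i ≡ᵇ k)) ≡ 1
∑<-δ-rowˡ {zero}  {zero}  _         = refl
∑<-δ-rowˡ {suc n} {zero}  _         = cong suc (∑<-0 n)
∑<-δ-rowˡ {suc n} {suc i} (s≤s i≤n) = ∑<-δ-rowˡ i≤n

∑<-below : ∀ {n i} → i ≤ n → ∑< n (λ k → 𝟙 (k <ᵇ i)) ≡ i
∑<-below {n}     {zero}  _         = ∑<-0 n
∑<-below {suc n} {suc i} (s≤s i≤n) = cong suc (∑<-below i≤n)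

-- Positions start at 0 and vertices at v₁, so the even positions hold the part L and the odd ones
-- the part R.
∑<-pairs : ∀ n f → ∑< (2 * n) f ≡ ∑< n (λ k → f (2 * k) + f (suc (2 * k)))
∑<-pairs zero    f = refl
∑<-pairs (suc n) f = begin
  ∑< (2 * suc n) f
    ≡⟨ cong (λ m → ∑< m f) (*-suc 2 n) ⟩
  f 0 + (f 1 + ∑< (2 * n) (λ k → f (2 + k)))
    ≡⟨ +-assoc (f 0) (f 1) _ ⟨
  f 0 + f 1 + ∑< (2 * n) (λ k → f (2 + k))
    ≡⟨ cong (_+_ (f 0 + f 1)) (∑<-pairs n (λ k → f (2 + k))) ⟩
  f 0 + f 1 + ∑< n (λ k → f (2 + 2 * k) + f (3 + 2 * k))
    ≡⟨ cong (_+_ (f 0 + f 1)) (∑<-cong n λ k _ →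
         cong₂ (λ p q → f p + f (suc q)) (*-suc 2 k) (*-suc 2 k)) ⟨
  f 0 + f 1 + ∑< n (λ k → f (2 * suc k) + f (suc (2 * suc k))) ∎
  where open ≡-Reasoning

above : ℕ → (ℕ → ℕ) → ℕ → ℕ
above n f i = ∑< n (λ k → 𝟙 (i <ᵇ k) * f k)

above-suc : ∀ {n i} f → suc i < n → above n f i ≡ f (suc i) + above n f (suc i)
above-suc {n} {i} f i<n = begin
  above n f i
    ≡⟨ ∑<-cong n (λ k _ → cong (_* f k) (split i k)) ⟩
  ∑< n (λ k → (𝟙 (k ≡ᵇ suc i) + 𝟙 (suc i <ᵇ k)) * f k)
    ≡⟨ ∑<-*-+ n (λ k → 𝟙 (k ≡ᵇ suc i)) (λ k → 𝟙 (suc i <ᵇ k)) f ⟩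
  ∑< n (λ k → 𝟙 (k ≡ᵇ suc i) * f k) + above n f (suc i)
    ≡⟨ cong (_+ above n f (suc i)) (∑<-δ f i<n) ⟩
  f (suc i) + above n f (suc i) ∎
  where
  open ≡-Reasoning
  split : ∀ i k → 𝟙 (i <ᵇ k) ≡ 𝟙 (k ≡ᵇ suc i) + 𝟙 (suc i <ᵇ k)
  split zero    zero          = refl
  split zero    (suc zero)    = refl
  split zero    (suc (suc k)) = refl
  split (suc i) zero          = refl
  split (suc i) (suc k)       = split i k

above-last : ∀ {n} i f → n ≤ suc i → above n f i ≡ 0
above-last {zero}  i       f _         = refl
above-last {suc n} zero    f (s≤s z≤n) = refl
above-last {suc n} (suc i) f (s≤s n≤i) = above-last i (f ∘ suc) n≤i

-- The balance equations and the growth of their solutions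

-- l k and r k are the numbers of firings of v₂ₖ₊₁ and v₂ₖ₊₂ in a period, where
-- k ≤ m = a - 1.
record Balanced (m : ℕ) (l r : ℕ → ℕ) : Set where
  field
    l-first : m * l 0 ≡ r m
    l-rest  : ∀ {i} → i < m → suc i * l (suc i) ≡ r i + above (suc m) r (suc i)
    r-lower : ∀ {i} → i < m → l (suc i) ≤ suc i * r (suc i)
    r-upper : ∀ {i} → i < m →
              suc i * r (suc i) ≤ l 0 + l (suc i) + above (suc m) l (2 + i)

module _ {m : ℕ} {l r : ℕ → ℕ} (balanced : Balanced m l r) where
  open Balanced balanced
  open ≤-Reasoning

  -- The equations yield r i and then l i from entries of larger index, so every argument runs from
  -- m down to a bound c, by induction on the distance d to m.
  downward : ∀ {p} (P : ℕ → Set p) c → P m → (∀ {i} → c ≤ i → i < m → P (suc i) → P i) →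
             ∀ d i → c ≤ i → d + i ≡ m → P i
  downward P c base step zero    i c≤i refl = base
  downward P c base step (suc d) i c≤i eq   =
    step c≤i (≤-trans (m≤n+m (suc i) d) (≤-reflexive eq′))
      (downward P c base step d (suc i) (m≤n⇒m≤1+n c≤i) eq′)
    where
    eq′ : d + suc i ≡ m
    eq′ = trans (+-suc d i) eq

  -- All terms are nonnegative, so zeros spread downwards: from l 0 to r m by `l-first`, from r i to
  -- l i by `r-lower`, and from l (i + 1) to r i by `l-rest`. Read contrapositively: if any vertex
  -- fires in a period, then v₁ does.
  vanishing : 1 ≤ m → l 0 ≡ 0 → ∀ {i} → i ≤ m → l i ≡ 0 × r i ≡ 0
  vanishing 1≤m l0≡0 {i} i≤m =
    downward (λ i → l i ≡ 0 × r i ≡ 0) 0 (base m refl 1≤m) (λ _ → step)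
      (m ∸ i) i z≤n (m∸n+n≡m i≤m)
    where
    rm≡0 : r m ≡ 0
    rm≡0 = trans (sym l-first) (trans (cong (m *_) l0≡0) (*-zeroʳ m))

    l≡0 : ∀ i → i ≤ m → r i ≡ 0 → l i ≡ 0
    l≡0 zero    _   _    = l0≡0
    l≡0 (suc i) i<m ri≡0 = n≤0⇒n≡0 (begin
      l (suc i)         ≤⟨ r-lower i<m ⟩
      suc i * r (suc i) ≡⟨ cong (suc i *_) ri≡0 ⟩
      suc i * 0         ≡⟨ *-zeroʳ (suc i) ⟩
      0                 ∎)

    base : ∀ i → i ≡ m → 1 ≤ m → l i ≡ 0 × r i ≡ 0
    base i refl _ = l≡0 m ≤-refl rm≡0 , rm≡0

    step : ∀ {i} → i < m → l (suc i) ≡ 0 × r (suc i) ≡ 0 → l i ≡ 0 × r i ≡ 0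
    step {i} i<m (l≡ , _) = l≡0 i (<⇒≤ i<m) ri≡0 , ri≡0
      where
      ri≡0 : r i ≡ 0
      ri≡0 = n≤0⇒n≡0 (begin
        r i                               ≤⟨ m≤m+n (r i) _ ⟩
        r i + above (suc m) r (suc i)     ≡⟨ l-rest i<m ⟨
        suc i * l (suc i)                 ≡⟨ cong (suc i *_) l≡ ⟩
        suc i * 0                         ≡⟨ *-zeroʳ (suc i) ⟩
        0                                 ∎)

  -- One step down multiplies l by at least (i - 1) * i, which is at least the
  -- factor i + 1 lost from the factorial only for 3 ≤ i; hence the constant 6 = 3 !.
  record Growing (i : ℕ) : Set where
    field
      r-dom : above (suc m) r i ≤ r i
      l-dom : l 0 + above (suc m) l i ≤ l i
      r≤l   : r i ≤ l i
      large : 6 * suc m ! ≤ l i * i !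

  -- Above m the tail sums are empty. So `r-upper` and r m = m · l 0 give m² · l 0 ≤ l 0 + l m, and
  -- hence `l-large`, from which all fields but `r-dom` follow.
  growing-last : 7 ≤ m → 1 ≤ l 0 → Growing m
  growing-last 7≤m 1≤l0 = record
    { r-dom = ≤-trans (≤-reflexive (above-last m r ≤-refl)) z≤n
    ; l-dom = begin
        l 0 + above (suc m) l m ≡⟨ cong (_+_ (l 0)) (above-last m l ≤-refl) ⟩
        l 0 + 0                 ≡⟨ +-identityʳ (l 0) ⟩
        l 0                     ≤⟨ m≤n*m (l 0) (6 * suc m) ⟩
        6 * suc m * l 0         ≤⟨ l-large ⟩
        l m                     ∎
    ; r≤l = begin
        r m                     ≡⟨ l-first ⟨
        m * l 0                 ≤⟨ *-monoˡ-≤ (l 0) (≤-trans (n≤1+n m) (m≤n*m (suc m) 6)) ⟩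
        6 * suc m * l 0         ≤⟨ l-large ⟩
        l m                     ∎
    ; large = begin
        6 * (suc m * m !)       ≡⟨ *-assoc 6 (suc m) (m !) ⟨
        6 * suc m * m !         ≤⟨ *-monoˡ-≤ (m !) (m≤m*n (6 * suc m) (l 0) {{>-nonZero 1≤l0}}) ⟩
        6 * suc m * l 0 * m !   ≤⟨ *-monoˡ-≤ (m !) l-large ⟩
        l m * m !               ∎
    }
    where
    m²-bound : ∀ {m} → 7 ≤ m → 1 + 6 * suc m ≤ m * m
    m²-bound {m} 7≤m with k , refl ← m≤n⇒∃[o]m+o≡n 7≤m = begin
      -- The difference of the two sides is (m - 7)(m + 1) = k (k + 8); this is where the bound 7
      -- comes from.
      1 + 6 * suc (7 + k)                      ≤⟨ m≤m+n _ (8 * k + k * k) ⟩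
      1 + 6 * suc (7 + k) + (8 * k + k * k)    ≡⟨ eq k ⟩
      (7 + k) * (7 + k)                        ∎
      where
      eq : ∀ k → 1 + 6 * suc (7 + k) + (8 * k + k * k) ≡ (7 + k) * (7 + k)
      eq = solve-∀

    r-upper-last : ∀ i → i ≡ m → 1 ≤ i → i * r i ≤ l 0 + l i
    r-upper-last (suc i) refl _ = begin
      suc i * r (suc i)                             ≤⟨ r-upper ≤-refl ⟩
      l 0 + l (suc i) + above (suc m) l (2 + i)     ≡⟨ cong (_+_ _) (above-last (2 + i) l (n≤1+n _)) ⟩
      l 0 + l (suc i) + 0                           ≡⟨ +-identityʳ _ ⟩
      l 0 + l (suc i)                               ∎

    l-large : 6 * suc m * l 0 ≤ l m
    l-large = +-cancelˡ-≤ (l 0) _ _ (begin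
      (1 + 6 * suc m) * l 0 ≤⟨ *-monoˡ-≤ (l 0) (m²-bound 7≤m) ⟩
      m * m * l 0           ≡⟨ *-assoc m m (l 0) ⟩
      m * (m * l 0)         ≡⟨ cong (m *_) l-first ⟩
      m * r m               ≤⟨ r-upper-last m refl (≤-trans (s≤s z≤n) 7≤m) ⟩
      l 0 + l m             ∎)

  -- By domination, a tail sum costs at most one copy of a known entry. In `l-rest` the tail is at
  -- most l (i + 1), which leaves r i ≥ i · l (i + 1). In `r-upper` the tail and l 0 together are at
  -- most l (i + 1) ≤ r i, which leaves l i ≥ (i - 1) · r i.
  growing-pred : ∀ {i} → 3 ≤ i → i < m → Growing (suc i) → Growing i
  growing-pred {i} 3≤i i<m grown with k , refl ← m≤n⇒∃[o]m+o≡n 3≤i = record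
    { r-dom = begin
        above (suc m) r i                         ≡⟨ above-suc r (s≤s i<m) ⟩
        r (suc i) + above (suc m) r (suc i)       ≤⟨ +-monoʳ-≤ (r (suc i)) r-dom ⟩
        r (suc i) + r (suc i)                     ≤⟨ +-mono-≤ r≤l r≤l ⟩
        l (suc i) + l (suc i)                     ≤⟨ l+l≤r ⟩
        r i                                       ∎
    ; l-dom = begin
        l 0 + above (suc m) l i                   ≡⟨ l-above ⟩
        l (suc i) + (l 0 + above (suc m) l (suc i)) ≤⟨ +-monoʳ-≤ (l (suc i)) l-dom ⟩
        l (suc i) + l (suc i)                     ≤⟨ l+l≤r ⟩
        r i                                       ≤⟨ r≤l′ ⟩
        l i                                       ∎
    ; r≤l = r≤l′
    ; large = begin
        6 * suc m !                     ≤⟨ large ⟩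
        l (suc i) * (suc i * i !)       ≡⟨ *-assoc (l (suc i)) (suc i) (i !) ⟨
        l (suc i) * suc i * i !         ≡⟨ cong (_* i !) (*-comm (l (suc i)) (suc i)) ⟩
        suc i * l (suc i) * i !         ≤⟨ *-monoˡ-≤ (i !) l-step ⟩
        l i * i !                       ∎
    }
    where
    open Growing grown

    r-step : i * l (suc i) ≤ r i
    r-step = +-cancelˡ-≤ (l (suc i)) _ _ (begin
      suc i * l (suc i)               ≡⟨ l-rest i<m ⟩
      r i + above (suc m) r (suc i)   ≤⟨ +-monoʳ-≤ (r i) (≤-trans r-dom r≤l) ⟩
      r i + l (suc i)                 ≡⟨ +-comm (r i) _ ⟩
      l (suc i) + r i                 ∎)

    l+l≤r : l (suc i) + l (suc i) ≤ r i
    l+l≤r = begin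
      l (suc i) + l (suc i)   ≡⟨ cong (_+_ (l (suc i))) (+-identityʳ (l (suc i))) ⟨
      2 * l (suc i)           ≤⟨ *-monoˡ-≤ (l (suc i)) (m≤m+n 2 (suc k)) ⟩
      i * l (suc i)           ≤⟨ r-step ⟩
      r i                     ∎

    l-above : l 0 + above (suc m) l i ≡ l (suc i) + (l 0 + above (suc m) l (suc i))
    l-above = trans (cong (_+_ (l 0)) (above-suc l (s≤s i<m)))
      (rearrange (l 0) (l (suc i)) _)
      where
      rearrange : ∀ x y z → x + (y + z) ≡ y + (x + z)
      rearrange = solve-∀

    -- Since i = 3 + k, the factor 2 + k is i - 1.
    r-step′ : (2 + k) * r i ≤ l i
    r-step′ = +-cancelˡ-≤ (r i) _ _ (begin
      i * r i                             ≤⟨ r-upper (≤-trans (n≤1+n i) i<m) ⟩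
      l 0 + l i + above (suc m) l (suc i) ≡⟨ rearrange (l 0) (l i) _ ⟩
      l 0 + above (suc m) l (suc i) + l i ≤⟨ +-monoˡ-≤ (l i) l-dom ⟩
      l (suc i) + l i                     ≤⟨ +-monoˡ-≤ (l i) (≤-trans (m≤m+n (l (suc i)) _) l+l≤r) ⟩
      r i + l i                           ∎)
      where
      rearrange : ∀ x y z → x + y + z ≡ x + z + y
      rearrange = solve-∀

    r≤l′ : r i ≤ l i
    r≤l′ = ≤-trans (m≤m+n (r i) _) r-step′

    l-step : suc i * l (suc i) ≤ l i
    l-step = begin
      (4 + k) * l (suc i)                 ≤⟨ *-monoˡ-≤ (l (suc i)) quadratic ⟩
      (2 + k) * (3 + k) * l (suc i)       ≡⟨ *-assoc (2 + k) (3 + k) (l (suc i)) ⟩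
      (2 + k) * (i * l (suc i))           ≤⟨ *-monoʳ-≤ (2 + k) r-step ⟩
      (2 + k) * r i                       ≤⟨ r-step′ ⟩
      l i                                 ∎
      where
      eq : ∀ k → 4 + k + (2 + k * 4 + k * k) ≡ (2 + k) * (3 + k)
      eq = solve-∀
      quadratic : 4 + k ≤ (2 + k) * (3 + k)
      quadratic = ≤-trans (m≤m+n (4 + k) _) (≤-reflexive (eq k))

  l₃-large : 7 ≤ m → 1 ≤ l 0 → suc m ! ≤ l 3
  l₃-large 7≤m 1≤l0 = *-cancelˡ-≤ 6 (begin
    6 * suc m !  ≤⟨ Growing.large (downward Growing 3 (growing-last 7≤m 1≤l0) growing-pred
                      (m ∸ 3) 3 ≤-refl (m∸n+n≡m (≤-trans (m≤m+n 3 4) 7≤m))) ⟩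
    l 3 * 6      ≡⟨ *-comm (l 3) 6 ⟩
    6 * l 3      ∎)

-- The adjacency matrix of the useful orientation

opaque
  -- Positions count from 0, hence the successors. Opacity keeps the case analysis of `usefulEdge?`
  -- folded while sums over the matrix are rewritten with the entry formulas below.
  adjacency : ℕ → ℕ → ℕ → ℕ
  adjacency a p q = 𝟙 (does (usefulEdge? a (suc p) (suc q)))

double-injective : ∀ {m n} → 2 * m ≡ 2 * n → m ≡ n
double-injective = *-cancelˡ-≡ _ _ 2

2*n+1≡suc : ∀ n → 2 * n + 1 ≡ suc (2 * n)
2*n+1≡suc n = +-comm (2 * n) 1

2*suc∸1 : ∀ n → 2 * suc n ∸ 1 ≡ suc (2 * n)
2*suc∸1 n = cong (_∸ 1) (*-suc 2 n)

-- Here and in the next three lemmas the endpoints enter through equations, because an index such as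
-- `2 * i` does not unify with `suc (2 * k)`. Constructors of the wrong parity are refuted by
-- `even≢odd`.
edge-LL : ∀ {a p q} j k → p ≡ suc (2 * j) → q ≡ suc (2 * k) → ¬ UsefulEdge a p q
edge-LL j k p≡ q≡ (path _ _) = even≢odd k j (trans (sym (suc-injective q≡)) p≡)
edge-LL {a} j k p≡ q≡ close = even≢odd a j p≡
edge-LL j k p≡ q≡ (first {i} _ _) = even≢odd i k q≡
edge-LL j k p≡ q≡ (odd {_} {k′} _ _ _ _) = even≢odd k′ k q≡
edge-LL j k p≡ q≡ (even {j′} _ _ _ _) = even≢odd j′ j p≡

edge-RR : ∀ {a p q} j k → p ≡ 2 * suc j → q ≡ 2 * suc k → ¬ UsefulEdge a p q
edge-RR j k p≡ q≡ (path _ _) = even≢odd (suc k) (suc j) (trans (sym q≡) (cong suc p≡))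
edge-RR j k p≡ q≡ close = even≢odd (suc k) 0 (sym q≡)
edge-RR j k p≡ q≡ (first _ _) = even≢odd (suc j) 0 (sym p≡)
edge-RR j k p≡ q≡ (odd {j′} _ _ _ _) = even≢odd (suc j) j′ (trans (sym p≡) (2*n+1≡suc j′))
edge-RR j k p≡ q≡ (even {_} {suc k′} _ _ _ _) =
  even≢odd (suc k) k′ (trans (sym q≡) (2*suc∸1 k′))

edge-LR : ∀ {a p q} j k → p ≡ suc (2 * j) → q ≡ 2 * suc k → UsefulEdge a p q →
          j ≡ k ⊎ (j ≡ 0 × suc k < a) ⊎ suc k < j
edge-LR j k p≡ q≡ (path _ _) = inj₁ (double-injective
  (suc-injective (suc-injective (trans (cong suc (sym p≡)) (trans q≡ (*-suc 2 k))))))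
edge-LR {a} j k p≡ q≡ close = contradiction p≡ (even≢odd a j)
edge-LR {a} j k p≡ q≡ (first {i} _ i<a) =
  inj₂ (inj₁ ( double-injective (sym (suc-injective p≡))
             , subst (_< a) (double-injective {i} q≡) i<a))
edge-LR j k p≡ q≡ (odd {j′} {k′} _ _ _ k′<j′) = inj₂ (inj₂ (subst₂ _<_
  (double-injective {k′} q≡)
  (double-injective {j′} (suc-injective (trans (sym (2*n+1≡suc j′)) p≡))) k′<j′))
edge-LR j k p≡ q≡ (even {j′} _ _ _ _) = contradiction p≡ (even≢odd j′ j)

edge-RL : ∀ {a p q} j k → p ≡ 2 * suc j → q ≡ suc (2 * k) → UsefulEdge a p q →
          k ≡ suc j ⊎ (suc j ≡ a × k ≡ 0) ⊎ (1 ≤ k × k < j)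
edge-RL j k p≡ q≡ (path _ _) =
  inj₁ (double-injective (trans (sym (suc-injective q≡)) p≡))
edge-RL j k p≡ q≡ close =
  inj₂ (inj₁ (double-injective (sym p≡) , double-injective (sym (suc-injective q≡))))
edge-RL j k p≡ q≡ (first {i} _ _) = contradiction q≡ (even≢odd i k)
edge-RL j k p≡ q≡ (odd {j′} _ _ _ _) =
  contradiction (trans (sym p≡) (2*n+1≡suc j′)) (even≢odd (suc j) j′)
edge-RL j k p≡ q≡ (even {j′} {suc k′} _ _ 1<k k<j)
  with refl ← double-injective {k′} {k} (suc-injective (trans (sym (2*suc∸1 k′)) q≡))
     | refl ← double-injective {j′} {suc j} p≡ = inj₂ (inj₂ (s≤s⁻¹ 1<k , s≤s⁻¹ k<j))


1+2*-<-2* : ∀ {j a} → j < a → suc (2 * j) < 2 * a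
1+2*-<-2* {j} {a} j<a = subst (_≤ 2 * a) (*-suc 2 j) (*-monoʳ-≤ 2 j<a)

opaque
  unfolding adjacency

  adjacency-LL : ∀ a j k → adjacency a (2 * j) (2 * k) ≡ 0
  adjacency-LL a j k = cong 𝟙 (dec-false (usefulEdge? a _ _) (edge-LL j k refl refl))

  adjacency-RR : ∀ a j k → adjacency a (suc (2 * j)) (suc (2 * k)) ≡ 0
  adjacency-RR a j k = cong 𝟙 (dec-false (usefulEdge? a _ _)
    (edge-RR j k (sym (*-suc 2 j)) (sym (*-suc 2 k))))

  adjacency-L₀R : ∀ {a} k → 2 ≤ a → adjacency a 0 (suc (2 * k)) ≡ 𝟙 (suc k <ᵇ a)
  adjacency-L₀R {a} k 2≤a =
    cong 𝟙 (does-⇔ (mk⇔ to from) (usefulEdge? a 1 (2 + 2 * k)) (suc k <? a))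
    where
    to : UsefulEdge a 1 (2 + 2 * k) → suc k < a
    to e with edge-LR 0 k refl (sym (*-suc 2 k)) e
    -- The cycle edge from v₁ to v₂ is also the case i = 1 of `first`, because 2 ≤ a.
    ... | inj₁ refl             = 2≤a
    ... | inj₂ (inj₁ (_ , k<a)) = k<a

    from : suc k < a → UsefulEdge a 1 (2 + 2 * k)
    from k<a = subst (UsefulEdge a 1) (*-suc 2 k) (first (s≤s z≤n) k<a)

  -- One edge along the cycle and edges to right vertices further down. The two cases exclude each
  -- other, so their disjunction becomes a sum of indicators, along which degrees and inflows split.
  adjacency-LR : ∀ {a j} k → suc j < a →
    adjacency a (2 * suc j) (suc (2 * k)) ≡ 𝟙 (suc j ≡ᵇ k) + 𝟙 (k <ᵇ j)
  adjacency-LR {a} {j} k j<a = trans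
    (cong 𝟙 (does-⇔ (mk⇔ to from) (usefulEdge? a (suc (2 * suc j)) (2 + 2 * k))
      ((suc j ≟ k) ⊎-dec (k <? j))))
    (disjoint j k)
    where
    to : UsefulEdge a (suc (2 * suc j)) (2 + 2 * k) → suc j ≡ k ⊎ k < j
    to e with edge-LR (suc j) k refl (sym (*-suc 2 k)) e
    ... | inj₁ eq               = inj₁ eq
    ... | inj₂ (inj₁ (() , _))
    ... | inj₂ (inj₂ (s≤s k<j)) = inj₂ k<j

    from : suc j ≡ k ⊎ k < j → UsefulEdge a (suc (2 * suc j)) (2 + 2 * k)
    from (inj₁ refl) = path (s≤s z≤n) (1+2*-<-2* j<a)
    from (inj₂ k<j)  = subst₂ (UsefulEdge a) (2*n+1≡suc (suc j)) (*-suc 2 k)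
      (odd (s≤s z≤n) (∸-monoˡ-≤ 1 j<a) (s≤s z≤n) (s≤s k<j))

    disjoint : ∀ j k → 𝟙 ((suc j ≡ᵇ k) ∨ (k <ᵇ j)) ≡ 𝟙 (suc j ≡ᵇ k) + 𝟙 (k <ᵇ j)
    disjoint zero    zero          = refl
    disjoint zero    (suc zero)    = refl
    disjoint zero    (suc (suc k)) = refl
    disjoint (suc j) zero          = refl
    disjoint (suc j) (suc k)       = disjoint j k

  adjacency-RL₀ : ∀ a j → adjacency a (suc (2 * j)) 0 ≡ 𝟙 (suc j ≡ᵇ a)
  adjacency-RL₀ a j =
    cong 𝟙 (does-⇔ (mk⇔ to from) (usefulEdge? a (2 + 2 * j) 1) (suc j ≟ a))
    where
    to : UsefulEdge a (2 + 2 * j) 1 → suc j ≡ a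
    to e with edge-RL j 0 (sym (*-suc 2 j)) refl e
    ... | inj₂ (inj₁ (eq , _)) = eq

    from : suc j ≡ a → UsefulEdge a (2 + 2 * j) 1
    from refl = subst (λ p → UsefulEdge a p 1) (*-suc 2 j) close

  adjacency-RL : ∀ {a j k} → j < a → suc k < a →
    adjacency a (suc (2 * j)) (2 * suc k) ≡ 𝟙 (j ≡ᵇ k) + 𝟙 (suc k <ᵇ j)
  adjacency-RL {a} {j} {k} j<a k<a = trans
    (cong 𝟙 (does-⇔ (mk⇔ to from) (usefulEdge? a (2 + 2 * j) (suc (2 * suc k)))
      ((j ≟ k) ⊎-dec (suc k <? j))))
    (disjoint j k)
    where
    to : UsefulEdge a (2 + 2 * j) (suc (2 * suc k)) → j ≡ k ⊎ suc k < j
    to e with edge-RL j (suc k) (sym (*-suc 2 j)) refl e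
    ... | inj₁ refl             = inj₁ refl
    ... | inj₂ (inj₁ (_ , ()))
    ... | inj₂ (inj₂ (_ , k<j)) = inj₂ k<j

    from : j ≡ k ⊎ suc k < j → UsefulEdge a (2 + 2 * j) (suc (2 * suc k))
    from (inj₁ refl) = subst₂ (UsefulEdge a) (*-suc 2 j) refl
      (path (≤-trans (s≤s z≤n) (≤-reflexive (sym (*-suc 2 j)))) (*-monoʳ-< 2 k<a))
    from (inj₂ k<j)  = subst₂ (UsefulEdge a) (*-suc 2 j) (2*suc∸1 (suc k))
      (even (s≤s z≤n) j<a (s≤s (s≤s z≤n)) (s≤s k<j))

    disjoint : ∀ j k → 𝟙 ((j ≡ᵇ k) ∨ (suc k <ᵇ j)) ≡ 𝟙 (j ≡ᵇ k) + 𝟙 (suc k <ᵇ j)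
    disjoint zero    zero    = refl
    disjoint zero    (suc k) = refl
    disjoint (suc j) zero    = refl
    disjoint (suc j) (suc k) = disjoint j k

-- Out-degrees and their total

∑<-L : ∀ a (f : ℕ → ℕ) → (∀ k → f (suc (2 * k)) ≡ 0) →
       ∑< (2 * a) f ≡ ∑< a (λ k → f (2 * k))
∑<-L a f odd≡0 = trans (∑<-pairs a f) (∑<-cong a λ k _ →
  trans (cong (_+_ (f (2 * k))) (odd≡0 k)) (+-identityʳ _))

∑<-R : ∀ a (f : ℕ → ℕ) → (∀ k → f (2 * k) ≡ 0) →
       ∑< (2 * a) f ≡ ∑< a (λ k → f (suc (2 * k)))
∑<-R a f even≡0 = trans (∑<-pairs a f) (∑<-cong a λ k _ →
  cong (_+ f (suc (2 * k))) (even≡0 k))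

degree : ℕ → ℕ → ℕ
degree a p = ∑< (2 * a) (adjacency a p)

degree-L : ∀ {a} j → degree a (2 * j) ≡ ∑< a (λ k → adjacency a (2 * j) (suc (2 * k)))
degree-L {a} j = ∑<-R a (adjacency a (2 * j)) (adjacency-LL a j)

degree-R : ∀ {a} j → degree a (suc (2 * j)) ≡ ∑< a (λ k → adjacency a (suc (2 * j)) (2 * k))
degree-R {a} j = ∑<-L a (adjacency a (suc (2 * j))) (adjacency-RR a j)

degree-L₀ : ∀ {m} → 1 ≤ m → degree (suc m) 0 ≡ m
degree-L₀ {m} 1≤m = begin
  degree (suc m) 0
    ≡⟨ degree-L {suc m} 0 ⟩
  ∑< (suc m) (λ k → adjacency (suc m) 0 (suc (2 * k)))
    ≡⟨ ∑<-cong (suc m) (λ k _ → adjacency-L₀R k (s≤s 1≤m)) ⟩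
  ∑< (suc m) (λ k → 𝟙 (k <ᵇ m))
    ≡⟨ ∑<-below (n≤1+n m) ⟩
  m ∎
  where open ≡-Reasoning

degree-L-suc : ∀ {a j} → suc j < a → degree a (2 * suc j) ≡ suc j
degree-L-suc {a} {j} j<a = begin
  degree a (2 * suc j)
    ≡⟨ degree-L {a} (suc j) ⟩
  ∑< a (λ k → adjacency a (2 * suc j) (suc (2 * k)))
    ≡⟨ ∑<-cong a (λ k _ → adjacency-LR k j<a) ⟩
  ∑< a (λ k → 𝟙 (suc j ≡ᵇ k) + 𝟙 (k <ᵇ j))
    ≡⟨ ∑<-distrib-+ a (λ k → 𝟙 (suc j ≡ᵇ k)) (λ k → 𝟙 (k <ᵇ j)) ⟩
  ∑< a (λ k → 𝟙 (suc j ≡ᵇ k)) + ∑< a (λ k → 𝟙 (k <ᵇ j))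
    ≡⟨ cong₂ _+_ (∑<-δ-row j<a) (∑<-below (<⇒≤ (<⇒≤ j<a))) ⟩
  suc j ∎
  where open ≡-Reasoning

-- The 1 is the cycle edge, whether it leads to the next left vertex or closes the cycle at v₁. The
-- remaining sum counts the left vertices from 1 to j - 1 and is evaluated separately for j = 0 and
-- j > 0.
degree-R-any : ∀ {m j} → j ≤ m →
  degree (suc m) (suc (2 * j)) ≡ 1 + ∑< m (λ k → 𝟙 (suc k <ᵇ j))
degree-R-any {m} {j} j≤m = begin
  degree (suc m) (suc (2 * j))
    ≡⟨ degree-R {suc m} j ⟩
  adjacency (suc m) (suc (2 * j)) 0 + ∑< m (λ k → adjacency (suc m) (suc (2 * j)) (2 * suc k))
    ≡⟨ cong₂ _+_ (adjacency-RL₀ (suc m) j)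
         (∑<-cong m (λ k k<m → adjacency-RL (s≤s j≤m) (s≤s k<m))) ⟩
  𝟙 (j ≡ᵇ m) + ∑< m (λ k → 𝟙 (j ≡ᵇ k) + 𝟙 (suc k <ᵇ j))
    ≡⟨ cong (_+_ (𝟙 (j ≡ᵇ m))) (∑<-distrib-+ m (λ k → 𝟙 (j ≡ᵇ k)) (λ k → 𝟙 (suc k <ᵇ j))) ⟩
  𝟙 (j ≡ᵇ m) + (∑< m (λ k → 𝟙 (j ≡ᵇ k)) + ∑< m (λ k → 𝟙 (suc k <ᵇ j)))
    ≡⟨ +-assoc (𝟙 (j ≡ᵇ m)) _ _ ⟨
  𝟙 (j ≡ᵇ m) + ∑< m (λ k → 𝟙 (j ≡ᵇ k)) + ∑< m (λ k → 𝟙 (suc k <ᵇ j))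
    ≡⟨ cong (_+ ∑< m (λ k → 𝟙 (suc k <ᵇ j))) (∑<-δ-rowˡ j≤m) ⟩
  1 + ∑< m (λ k → 𝟙 (suc k <ᵇ j)) ∎
  where open ≡-Reasoning

degree-R₀ : ∀ m → degree (suc m) 1 ≡ 1
degree-R₀ m = trans (degree-R-any {m} z≤n) (cong suc (∑<-0 m))

degree-R-suc : ∀ {m j} → j < m → degree (suc m) (suc (2 * suc j)) ≡ suc j
degree-R-suc j<m = trans (degree-R-any j<m) (cong suc (∑<-below (<⇒≤ j<m)))

-- The degrees are m for v₁ and 1 for v₂, followed by each of 1, ..., m twice.
∑-degree : ∀ {m} → 1 ≤ m → ∑< (2 * suc m) (degree (suc m)) ≡ suc m * suc m
∑-degree {m} 1≤m = begin
  ∑< (2 * suc m) d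
    ≡⟨ ∑<-pairs (suc m) d ⟩
  d 0 + d 1 + ∑< m (λ k → d (2 * suc k) + d (suc (2 * suc k)))
    ≡⟨ cong₂ _+_ (cong₂ _+_ (degree-L₀ 1≤m) (degree-R₀ m))
         (∑<-cong m λ k k<m → cong₂ _+_ (degree-L-suc (s≤s k<m)) (degree-R-suc k<m)) ⟩
  m + 1 + ∑< m (λ k → suc k + suc k)
    ≡⟨ cong (_+_ (m + 1)) (∑-progression 0 m) ⟩
  m + 1 + m * (1 + m + 2 * 0)
    ≡⟨ square m ⟩
  suc m * suc m ∎
  where
  open ≡-Reasoning
  d = degree (suc m)

  square : ∀ m → m + 1 + m * (1 + m + 2 * 0) ≡ suc m * suc m
  square = solve-∀

  advance : ∀ c n → suc c + suc c + n * (1 + n + 2 * suc c) ≡ suc n * (1 + suc n + 2 * c)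
  advance = solve-∀

  -- The offset c is there for the induction: dropping the first term shifts the progression by one.
  ∑-progression : ∀ c n →
    ∑< n (λ k → suc (c + k) + suc (c + k)) ≡ n * (1 + n + 2 * c)
  ∑-progression c zero    = refl
  ∑-progression c (suc n) = trans
    (cong₂ _+_ (cong (λ i → suc i + suc i) (+-identityʳ c)) (trans
      (∑<-cong n λ k _ → cong (λ i → suc i + suc i) (+-suc c k))
      (∑-progression (suc c) n)))
    (advance c n)

-- From inflows to the balance equations

inflow : ℕ → (ℕ → ℕ) → ℕ → ℕ
inflow a x p = ∑< (2 * a) (λ q → adjacency a q p * x q)

left right : (ℕ → ℕ) → ℕ → ℕ
left  x k = x (2 * k)
right x k = x (suc (2 * k))

module _ {m : ℕ} (x : ℕ → ℕ) where
  open ≡-Reasoning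

  private
    l = left x
    r = right x

  inflow-L : ∀ k → inflow (suc m) x (2 * k) ≡
             ∑< (suc m) (λ j → adjacency (suc m) (suc (2 * j)) (2 * k) * r j)
  inflow-L k = ∑<-R (suc m) (λ q → adjacency (suc m) q (2 * k) * x q)
    (λ j → cong (_* l j) (adjacency-LL (suc m) j k))

  inflow-R : ∀ k → inflow (suc m) x (suc (2 * k)) ≡
             ∑< (suc m) (λ j → adjacency (suc m) (2 * j) (suc (2 * k)) * l j)
  inflow-R k = ∑<-L (suc m) (λ q → adjacency (suc m) q (suc (2 * k)) * x q)
    (λ j → cong (_* r j) (adjacency-RR (suc m) j k))

  inflow-L₀ : inflow (suc m) x 0 ≡ r m
  inflow-L₀ = begin
    inflow (suc m) x 0
      ≡⟨ inflow-L 0 ⟩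
    ∑< (suc m) (λ j → adjacency (suc m) (suc (2 * j)) 0 * r j)
      ≡⟨ ∑<-cong (suc m) (λ j _ → cong (_* r j) (adjacency-RL₀ (suc m) j)) ⟩
    ∑< (suc m) (λ j → 𝟙 (j ≡ᵇ m) * r j)
      ≡⟨ ∑<-δ {i = m} r ≤-refl ⟩
    r m ∎

  inflow-L-suc : ∀ {k} → k < m →
    inflow (suc m) x (2 * suc k) ≡ r k + above (suc m) r (suc k)
  inflow-L-suc {k} k<m = begin
    inflow (suc m) x (2 * suc k)
      ≡⟨ inflow-L (suc k) ⟩
    ∑< (suc m) (λ j → adjacency (suc m) (suc (2 * j)) (2 * suc k) * r j)
      ≡⟨ ∑<-cong (suc m) (λ j j<a → cong (_* r j) (adjacency-RL j<a (s≤s k<m))) ⟩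
    ∑< (suc m) (λ j → (𝟙 (j ≡ᵇ k) + 𝟙 (suc k <ᵇ j)) * r j)
      ≡⟨ ∑<-*-+ (suc m) (λ j → 𝟙 (j ≡ᵇ k)) (λ j → 𝟙 (suc k <ᵇ j)) r ⟩
    ∑< (suc m) (λ j → 𝟙 (j ≡ᵇ k) * r j) + above (suc m) r (suc k)
      ≡⟨ cong (_+ above (suc m) r (suc k)) (∑<-δ r (<⇒≤ (s≤s k<m))) ⟩
    r k + above (suc m) r (suc k) ∎

  inflow-R-suc : ∀ {k} → k < m → inflow (suc m) x (suc (2 * suc k)) ≡
    𝟙 (suc k <ᵇ m) * l 0 + (l (suc k) + above (suc m) l (2 + k))
  inflow-R-suc {k} k<m = begin
    inflow (suc m) x (suc (2 * suc k))
      ≡⟨ inflow-R (suc k) ⟩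
    adjacency (suc m) 0 (suc (2 * suc k)) * l 0 +
    ∑< m (λ j → adjacency (suc m) (2 * suc j) (suc (2 * suc k)) * l (suc j))
      ≡⟨ cong₂ _+_
           (cong (_* l 0) (adjacency-L₀R (suc k) (s≤s (≤-trans (s≤s z≤n) k<m))))
           (∑<-cong m λ j j<m → cong (_* l (suc j)) (adjacency-LR (suc k) (s≤s j<m))) ⟩
    𝟙 (suc k <ᵇ m) * l 0 + ∑< m (λ j → (𝟙 (j ≡ᵇ k) + 𝟙 (suc k <ᵇ j)) * l (suc j))
      ≡⟨ cong (_+_ (𝟙 (suc k <ᵇ m) * l 0))
           (∑<-*-+ m (λ j → 𝟙 (j ≡ᵇ k)) (λ j → 𝟙 (suc k <ᵇ j)) (l ∘ suc)) ⟩
    -- The tail sum arises by computation: its term at index 0 is 0, and the others are shifted by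
    -- one.
    𝟙 (suc k <ᵇ m) * l 0 +
    (∑< m (λ j → 𝟙 (j ≡ᵇ k) * l (suc j)) + above (suc m) l (2 + k))
      ≡⟨ cong (λ s → 𝟙 (suc k <ᵇ m) * l 0 + (s + above (suc m) l (2 + k)))
           (∑<-δ (l ∘ suc) k<m) ⟩
    𝟙 (suc k <ᵇ m) * l 0 + (l (suc k) + above (suc m) l (2 + k)) ∎

  inflow⇒balanced : 1 ≤ m →
    (∀ {p} → p < 2 * suc m → degree (suc m) p * x p ≡ inflow (suc m) x p) →
    Balanced m l r
  inflow⇒balanced 1≤m eq = record
    { l-first = begin
        m * l 0                  ≡⟨ cong (_* l 0) (degree-L₀ 1≤m) ⟨
        degree (suc m) 0 * l 0   ≡⟨ eq {0} (s≤s z≤n) ⟩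
        inflow (suc m) x 0       ≡⟨ inflow-L₀ ⟩
        r m                      ∎
    ; l-rest = λ {i} i<m → begin
        suc i * l (suc i)                         ≡⟨ cong (_* l (suc i)) (degree-L-suc (s≤s i<m)) ⟨
        degree (suc m) (2 * suc i) * l (suc i)    ≡⟨ eq (<⇒≤ (1+2*-<-2* (s≤s i<m))) ⟩
        inflow (suc m) x (2 * suc i)              ≡⟨ inflow-L-suc i<m ⟩
        r i + above (suc m) r (suc i)             ∎
    -- The vertex v₁ points to every right vertex except v₂ₐ. Dropping its term for the lower bound
    -- and always counting it for the upper one makes both uniform in i.
    ; r-lower = λ {i} i<m → ≤-trans
        (≤-trans (m≤m+n (l (suc i)) _) (m≤n+m _ (𝟙 (suc i <ᵇ m) * l 0)))
        (≤-reflexive (sym (r-balance i<m)))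
    ; r-upper = λ {i} i<m → ≤-trans (≤-reflexive (r-balance i<m)) (≤-trans
        (+-monoˡ-≤ _ (𝟙*n≤n (suc i <ᵇ m) (l 0)))
        (≤-reflexive (sym (+-assoc (l 0) (l (suc i)) _))))
    }
    where
    r-balance : ∀ {i} → i < m → suc i * r (suc i) ≡
      𝟙 (suc i <ᵇ m) * l 0 + (l (suc i) + above (suc m) l (2 + i))
    r-balance {i} i<m = begin
      suc i * r (suc i)                              ≡⟨ cong (_* r (suc i)) (degree-R-suc i<m) ⟨
      degree (suc m) (suc (2 * suc i)) * r (suc i)   ≡⟨ eq (1+2*-<-2* (s≤s i<m)) ⟩
      inflow (suc m) x (suc (2 * suc i))             ≡⟨ inflow-R-suc i<m ⟩
      𝟙 (suc i <ᵇ m) * l 0 + (l (suc i) + above (suc m) l (2 + i)) ∎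

    𝟙*n≤n : ∀ b n → 𝟙 b * n ≤ n
    𝟙*n≤n false n = z≤n
    𝟙*n≤n true  n = ≤-reflexive (+-identityʳ n)

-- Firing counts in an arbitrary digraph

sum-mono-≤ : ∀ {n} {f g : Fin n → ℕ} → (∀ i → f i ≤ g i) → sum f ≤ sum g
sum-mono-≤ {zero}  f≤g = z≤n
sum-mono-≤ {suc n} f≤g = +-mono-≤ (f≤g Fin.zero) (sum-mono-≤ (f≤g ∘ Fin.suc))

sum-ones : ∀ n → ∑[ i < n ] 1 ≡ n
sum-ones zero    = refl
sum-ones (suc n) = cong suc (sum-ones n)

module Counting {n : ℕ} (D : Digraph n) where
  open Digraph D
  open ChipFiring D

  -- If every vertex waits, each holds at least one chip less than its out-degree; summed over the
  -- vertices this contradicts `few`.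
  some-fires : ∀ τ → ∑[ v < n ] outdeg v < sum τ + n → ∃[ v ] outdeg v ≤ τ v
  some-fires τ few with any? (fires? τ)
  ... | yes firing = firing
  ... | no  none   = contradiction few (≤⇒≯ (begin
    sum τ + n             ≡⟨ cong (_+_ (sum τ)) (sum-ones n) ⟨
    sum τ + ∑[ v < n ] 1  ≡⟨ ∑-distrib-+ τ (λ _ → 1) ⟨
    ∑[ v < n ] (τ v + 1)  ≤⟨ sum-mono-≤ (λ v →
                               ≤-trans (≤-reflexive (+-comm (τ v) 1)) (≰⇒> λ d≤τ → none (v , d≤τ))) ⟩
    ∑[ v < n ] outdeg v   ∎))
    where open ≤-Reasoning

  module _ (σ : Config n) (t₀ : ℕ) where

    -- Rounds are written `t + t₀`, so that raising t by one unfolds to one further `step` of the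
    -- game.
    firings : ℕ → Fin n → ℕ
    firings zero    v = 0
    firings (suc t) v = firings t v + 𝟙 (does (fires? (game σ (t + t₀)) v))

    firings≤ : ∀ t v → firings t v ≤ t
    firings≤ zero    v = z≤n
    firings≤ (suc t) v = ≤-trans (+-mono-≤ (firings≤ t v) (𝟙≤1 (does (fires? (game σ (t + t₀)) v))))
      (≤-reflexive (+-comm t 1))
      where
      𝟙≤1 : ∀ b → 𝟙 b ≤ 1
      𝟙≤1 false = z≤n
      𝟙≤1 true  = ≤-refl

    -- Chips present plus chips sent equal chips at the start plus chips received; the additive form
    -- avoids truncated subtraction.
    firings-conserve : ∀ t v → game σ (t + t₀) v + outdeg v * firings t v ≡
      game σ t₀ v + ∑[ u < n ] (𝟙 (does (edge? u v)) * firings t u)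
    firings-conserve zero    v = cong (_+_ (game σ t₀ v)) (begin
      outdeg v * 0                                  ≡⟨ *-zeroʳ (outdeg v) ⟩
      0                                             ≡⟨ ∑<-0 n ⟨
      ∑[ u < n ] 0                                  ≡⟨ sum-cong-≗ (λ u → *-zeroʳ (𝟙 (does (edge? u v)))) ⟨
      ∑[ u < n ] (𝟙 (does (edge? u v)) * 0)         ∎)
      where open ≡-Reasoning
    firings-conserve (suc t) v = begin
      kept τ v + S + d * (f v + 𝟙 (does (fires? τ v)))
        ≡⟨ regroup (kept τ v) S d (f v) (𝟙 (does (fires? τ v))) ⟩
      kept τ v + d * 𝟙 (does (fires? τ v)) + (d * f v + S)
        ≡⟨ cong (_+ (d * f v + S)) (kept+lost (fires? τ v)) ⟩
      τ v + (d * f v + S)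
        ≡⟨ +-assoc (τ v) (d * f v) S ⟨
      τ v + d * f v + S
        ≡⟨ cong (_+ S) (firings-conserve t v) ⟩
      game σ t₀ v + ∑[ u < n ] (𝟙 (does (edge? u v)) * f u) + S
        ≡⟨ +-assoc (game σ t₀ v) _ S ⟩
      game σ t₀ v + (∑[ u < n ] (𝟙 (does (edge? u v)) * f u) + S)
        ≡⟨ cong (_+_ (game σ t₀ v)) (∑-distrib-+ (λ u → 𝟙 (does (edge? u v)) * f u) (λ u → sent τ u v)) ⟨
      game σ t₀ v + ∑[ u < n ] (𝟙 (does (edge? u v)) * f u + sent τ u v)
        ≡⟨ cong (_+_ (game σ t₀ v)) (sum-cong-≗ λ u →
             received (does (fires? τ u)) (does (edge? u v)) (f u)) ⟩
      game σ t₀ v + ∑[ u < n ] (𝟙 (does (edge? u v)) * (f u + 𝟙 (does (fires? τ u)))) ∎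
      where
      open ≡-Reasoning
      τ = game σ (t + t₀)
      f = firings t
      d = outdeg v
      S = ∑[ u < n ] sent τ u v

      regroup : ∀ k s d f b → k + s + d * (f + b) ≡ k + d * b + (d * f + s)
      regroup = solve-∀

      kept+lost : (fire? : Dec (d ≤ τ v)) →
        (if does fire? then τ v ∸ d else τ v) + d * 𝟙 (does fire?) ≡ τ v
      kept+lost (yes d≤τ) = trans (cong (_+_ (τ v ∸ d)) (*-identityʳ d)) (m∸n+n≡m d≤τ)
      kept+lost (no  _)   = trans (cong (_+_ (τ v)) (*-zeroʳ d)) (+-identityʳ (τ v))

      received : ∀ b e k → 𝟙 e * k + 𝟙 (b ∧ e) ≡ 𝟙 e * (k + 𝟙 b)
      received false e     k = trans (+-identityʳ _) (cong (_*_ (𝟙 e)) (sym (+-identityʳ k)))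
      received true  false k = refl
      received true  true  k = single k
        where
        single : ∀ k → 1 * k + 1 ≡ 1 * (k + 1)
        single = solve-∀

    firings-balanced : ∀ {T} → (∀ v → game σ t₀ v ≡ game σ (t₀ + T) v) → ∀ v →
      outdeg v * firings T v ≡ ∑[ u < n ] (𝟙 (does (edge? u v)) * firings T u)
    firings-balanced {T} repeats v = +-cancelˡ-≡ (game σ t₀ v) _ _ (begin
      game σ t₀ v + outdeg v * firings T v
        ≡⟨ cong (_+ outdeg v * firings T v) (repeats v) ⟩
      game σ (t₀ + T) v + outdeg v * firings T v
        ≡⟨ cong (λ t → game σ t v + outdeg v * firings T v) (+-comm t₀ T) ⟩
      game σ (T + t₀) v + outdeg v * firings T v
        ≡⟨ firings-conserve T v ⟩
      game σ t₀ v + ∑[ u < n ] (𝟙 (does (edge? u v)) * firings T u) ∎)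
      where open ≡-Reasoning

    -- The number of chips never changes, so `some-fires` applies in every round; the last of the T
    -- rounds supplies the vertex.
    firings-positive : ∑[ v < n ] outdeg v < sum σ + n → ∀ {T} → 0 < T → ∃[ v ] 0 < firings T v
    firings-positive few {suc t} _ with some-fires (game σ (t + t₀))
      (subst (λ s → ∑[ v < n ] outdeg v < s + n) (sym (sum-game D σ (t + t₀))) few)
    ... | v , fires = v , ≤-trans
      (≤-reflexive (cong 𝟙 (sym (dec-true (fires? (game σ (t + t₀)) v) fires))))
      (m≤n+m _ (firings t v))

-- Firing counts of the useful orientation and the factorial bound

extend : ∀ {n} → (Fin n → ℕ) → ℕ → ℕ
extend {n} f p with p <? n
... | yes p<n = f (fromℕ< p<n)
-- With the default 0, `extend-≤` holds at every position, without a check that it lies in range.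
... | no  _   = 0

extend-toℕ : ∀ {n} (f : Fin n → ℕ) i → extend f (toℕ i) ≡ f i
extend-toℕ {n} f i with toℕ i <? n
... | yes i<n = cong f (fromℕ<-toℕ i i<n)
... | no  i≮n = contradiction (toℕ<n i) i≮n

extend-fromℕ< : ∀ {n} (P : ℕ → ℕ → Set) (f : Fin n → ℕ) →
                (∀ i → P (toℕ i) (f i)) → ∀ {p} → p < n → P p (extend f p)
extend-fromℕ< P f Pf p<n = subst (λ p → P p (extend f p)) (toℕ-fromℕ< p<n)
  (subst (P _) (sym (extend-toℕ f (fromℕ< p<n))) (Pf (fromℕ< p<n)))

extend-≤ : ∀ {n b} (f : Fin n → ℕ) → (∀ i → f i ≤ b) → ∀ p → extend f p ≤ b
extend-≤ {n} f f≤b p with p <? n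
... | yes p<n = f≤b (fromℕ< p<n)
... | no  _   = z≤n

module _ {a : ℕ} where
  open ChipFiring (usefulK a)

  opaque
    unfolding adjacency

    outdeg≡degree : ∀ v → outdeg v ≡ degree a (toℕ v)
    outdeg≡degree v = refl

    inflow-extend : ∀ (f : Fin (2 * a) → ℕ) v →
      ∑[ u < 2 * a ] (𝟙 (does (Digraph.edge? (usefulK a) u v)) * f u) ≡
      inflow a (extend f) (toℕ v)
    inflow-extend f v = sum-cong-≗ λ u →
      cong (_*_ (adjacency a (toℕ u) (toℕ v))) (sym (extend-toℕ f u))

factorial≤period : ∀ {m T} → 7 ≤ m →
  PeriodWithAtLeast (usefulK (suc m)) (suc m * (suc m ∸ 2) + 1) T → suc m ! ≤ T
factorial≤period {m} {T} 7≤m (σ , chips , (0<T , t₀ , repeats) , _) =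
  -- Position 6 is 2 · 3: it holds v₇, whose count is `left x 3`.
  ≤-trans (l₃-large balanced 7≤m (n≢0⇒n>0 l₀≢0)) (extend-≤ count (firings≤ σ t₀ T) 6)
  where
  a = suc m
  D = usefulK a
  open ChipFiring D
  open Counting D

  1≤m : 1 ≤ m
  1≤m = ≤-trans (s≤s z≤n) 7≤m

  count : Fin (2 * a) → ℕ
  count = firings σ t₀ T

  x : ℕ → ℕ
  x = extend count

  balanced : Balanced m (left x) (right x)
  balanced = inflow⇒balanced x 1≤m (extend-fromℕ<
    (λ p k → degree a p * k ≡ inflow a x p) count λ v → begin
      degree a (toℕ v) * count v      ≡⟨ cong (_* count v) (outdeg≡degree {a} v) ⟨
      outdeg v * count v              ≡⟨ firings-balanced σ t₀ (repeats t₀ ≤-refl) v ⟩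
      ∑[ u < 2 * a ] (𝟙 (does (Digraph.edge? D u v)) * count u)
                                      ≡⟨ inflow-extend {a} count v ⟩
      inflow a x (toℕ v)              ∎)
    where open ≡-Reasoning

  few : ∑[ v < 2 * a ] outdeg v < sum σ + 2 * a
  few = begin-strict
    ∑[ v < 2 * a ] outdeg v     ≡⟨ sum-cong-≗ (outdeg≡degree {a}) ⟩
    ∑< (2 * a) (degree a)       ≡⟨ ∑-degree 1≤m ⟩
    a * a                       ≡⟨ square 1≤m ⟩
    -- The threshold a (a - 2) + 1 exceeds the number of edges minus the number of vertices by
    -- exactly one.
    a * (a ∸ 2) + 2 * a         <⟨ +-monoˡ-< (2 * a) (≤-trans (≤-reflexive (+-comm 1 _)) chips) ⟩
    sum σ + 2 * a               ∎
    where
    open ≤-Reasoning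
    expand : ∀ k → (2 + k) * (2 + k) ≡ (2 + k) * k + 2 * (2 + k)
    expand = solve-∀
    square : ∀ {m} → 1 ≤ m → suc m * suc m ≡ suc m * (suc m ∸ 2) + 2 * suc m
    square {suc k} _ = expand k

  l₀≢0 : left x 0 ≢ 0
  l₀≢0 l₀≡0 with firings-positive σ t₀ few 0<T
  -- Were v₁ idle throughout the period, `vanishing` would make the total number of firings 0, yet v
  -- fires.
  ... | v , fired = <⇒≱ fired (begin
    count v                                       ≤⟨ term≤sum D count v ⟩
    sum count                                     ≡⟨ sum-cong-≗ (extend-toℕ count) ⟨
    ∑< (2 * a) x                                  ≡⟨ ∑<-pairs a x ⟩
    ∑< a (λ k → left x k + right x k)            ≡⟨ ∑<-cong a (λ k k<a →
      let l≡0 , r≡0 = vanishing balanced 1≤m l₀≡0 (s≤s⁻¹ k<a) in cong₂ _+_ l≡0 r≡0) ⟩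
    ∑< a (λ _ → 0)                                ≡⟨ ∑<-0 a ⟩
    0                                             ∎)
    where open ≤-Reasoning

theorem3p15 :
    ∃[ κ ] (0ℚ <ℚ κ × ∃[ N ] (∀ a → 2 ≤ a → N ≤ a →
      ∀ T → IsConvergentPeriod (usefulK a) (a * (a ∸ 2) + 1) T →
      κ *ℚ (+ (a !) / 1) ≤ℚ (+ T / 1)))
-- The bound holds with constant 1, and N = 8 because m = a - 1 must be at least 7.
theorem3p15 = 1ℚ , ℚ.positive⁻¹ 1ℚ , 8 , λ where
  (suc m) _ (s≤s 7≤m) T (period , _) → subst (_≤ℚ (+ T / 1))
    (sym (ℚ.*-identityˡ (+ (suc m !) / 1)))
    (/1-mono-≤ (factorial≤period 7≤m period))
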